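{- Let $G$ be a finite, connected, simple $3$-regular graph on more than $6$ vertices that is $4$-ordered. Then $G$ does not contain a square, i.e. $G$ has no cycle of length $4$.
   Context: A simple graph $G$ is called $k$-ordered if for every sequence $v_1,\ldots,v_k$ of $k$ distinct vertices of $G$ there exists a cycle in $G$ containing these $k$ vertices in the specified (cyclic) order. -}

module Defs where

open import Data.Fin using (Fin)
open import Data.Fin.Subset using (Subset; ∣_∣)
open import Data.List using (List; _∷_; _∷ʳ_; length)
open import Data.List.Relation.Binary.Sublist.Propositional using (_⊆_)
open import Data.List.Relation.Unary.Linked using (Linked)
open import Data.List.Relation.Unary.Unique.Propositional using (Unique)
open import Data.Nat using (ℕ; _≤_)
open import Data.Product using (∃; _×_)
open import Data.Vec using (tabulate)
open import Level using (0ℓ)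
open import Relation.Binary using (Rel; Decidable; Symmetric; Irreflexive)
open import Relation.Binary.Construct.Closure.ReflexiveTransitive using (Star)
open import Relation.Binary.PropositionalEquality using (_≡_)
open import Relation.Nullary using (does)

-- Adjacency is decidable, as it is classically for any finite graph.
record SimpleGraph (n : ℕ) : Set₁ where
  infix 4 _~_ _~?_
  field
    _~_      : Rel (Fin n) 0ℓ
    _~?_     : Decidable _~_
    ~-sym    : Symmetric _~_
    ~-irrefl : Irreflexive _≡_ _~_

  neighbours : Fin n → Subset n
  neighbours v = tabulate (λ w → does (v ~? w))

  degree : Fin n → ℕ
  degree v = ∣ neighbours v ∣

  Regular : ℕ → Set
  Regular d = ∀ v → degree v ≡ d

  Connected : Set
  Connected = ∀ u v → Star _~_ u v

  -- IsCycle c: the list c runs once around a cycle of the graph, from some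
  -- starting vertex and in some direction.  The starting vertex is not repeated
  -- at the end of c, so length c is the length of the cycle.
  data IsCycle : List (Fin n) → Set where
    cycle : ∀ {v vs} → 3 ≤ length (v ∷ vs) → Unique (v ∷ vs) →
            Linked _~_ (v ∷ vs ∷ʳ v) → IsCycle (v ∷ vs)

  HasCycleOfLength : ℕ → Set
  HasCycleOfLength m = ∃ λ c → IsCycle c × length c ≡ m

  -- _⊆_ is the order-preserving sublist relation.  A cycle is listed by every
  -- rotation and reversal of c, so it meets the vertices of vs in the given
  -- cyclic order exactly when vs is a sublist of one of its listings.
  Ordered : ℕ → Set
  Ordered k = ∀ vs → length vs ≡ k → Unique vs → ∃ λ c → IsCycle c × vs ⊆ c

-- The four-vertex sequence (p, q, s, x) demands a path from s to x avoiding p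
-- and q, so no two vertices p, q separate G.  Let a b c d be a square.  A chord
-- ac would make {b, d} such a pair, so a and c have third neighbours a′ and c′
-- off the square.  If a′ ≠ c′, take a cycle through (c′, a, c, a′): next to a it
-- cannot use a′ and next to c it cannot use c′, so both neighbours of a are b and
-- d, and none is left for the vertex after c.  Hence a′ = c′, likewise b′ = d′,
-- and {a′, b′} separates the square from the remaining vertices.
module Submission where

open import Defs
open import Data.Empty using (⊥; ⊥-elim)
open import Data.Fin using (Fin; zero; suc; _≟_)
open import Data.Fin.Properties using (any?; injective⇒≤)
open import Data.Fin.Subset using (Subset; inside; outside; ∣_∣; _-_)
  renaming (_∈_ to _∈ˢ_)
open import Data.Fin.Subset.Properties
  using (nonempty?; Empty-unique; ∣⊥∣≡0; p─q⊆p; p─⊥≡p; x∈p∧x≢y⇒x∈p-y; x∈p⇒∣p-x∣<∣p∣)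
open import Data.List using (List; []; _∷_; _++_; length)
open import Data.List.Membership.DecPropositional using (_∈?_)
open import Data.List.Membership.Propositional using (_∈_; _∉_)
open import Data.List.Membership.Setoid.Properties using (index-injective)
open import Data.List.Relation.Binary.Sublist.Propositional
  using (_⊆_; _∷_; _∷ʳ_; lookup; ⊆-refl)
open import Data.List.Relation.Binary.Sublist.Propositional.Properties using (All-resp-⊆)
open import Data.List.Relation.Unary.All as All using (All; []; _∷_)
open import Data.List.Relation.Unary.AllPairs using ([]; _∷_)
open import Data.List.Relation.Unary.Any using (here; there; index)
open import Data.List.Relation.Unary.Linked as Linked using (Linked; []; [-]; _∷_)
open import Data.List.Relation.Unary.Unique.Propositional using (Unique)
open import Data.Nat using (ℕ; suc; _<_; _>_)
open import Data.Nat.Properties using (≤⇒≯; ≤-trans; suc-injective; n≮0; m≤m+n)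
open import Data.Product using (∃; ∃₂; _×_; _,_)
open import Data.Vec using ([]; _∷_)
import Data.Vec.Base as Vec
open import Data.Vec.Properties using ([]=⇒lookup; lookup⇒[]=; lookup∘tabulate)
open import Function using (_∘_)
open import Relation.Binary.PropositionalEquality
  using (_≡_; _≢_; refl; sym; trans; cong; subst; setoid; ≢-sym)
open import Relation.Nullary using (¬_; yes; no; ¬?; contradiction)
open import Relation.Nullary.Decidable using (dec-true; decidable-stable)

-- Counting in finite sets.

suc∣p-x∣≡∣p∣ : ∀ {n} {p : Subset n} {x} → x ∈ˢ p → suc ∣ p - x ∣ ≡ ∣ p ∣
suc∣p-x∣≡∣p∣ {p = _ ∷ p} Vec.here = cong (suc ∘ ∣_∣) (p─⊥≡p p)
suc∣p-x∣≡∣p∣ {p = inside ∷ p} (Vec.there x∈p) = cong suc (suc∣p-x∣≡∣p∣ x∈p)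
suc∣p-x∣≡∣p∣ {p = outside ∷ p} (Vec.there x∈p) = suc∣p-x∣≡∣p∣ x∈p

∣p-x∣≡pred∣p∣ : ∀ {n k} {p : Subset n} {x} → ∣ p ∣ ≡ suc k → x ∈ˢ p → ∣ p - x ∣ ≡ k
∣p-x∣≡pred∣p∣ ∣p∣≡1+k x∈p = suc-injective (trans (suc∣p-x∣≡∣p∣ x∈p) ∣p∣≡1+k)

x∈p-y⇒x≢y : ∀ {n} {p : Subset n} {x y} → x ∈ˢ p - y → x ≢ y
x∈p-y⇒x≢y {p = _ ∷ _} {y = zero} () refl
x∈p-y⇒x≢y {p = _ ∷ _} {y = suc _} (Vec.there x∈) refl = x∈p-y⇒x≢y x∈ refl

-- Taking away `x` and `y` leaves a single element `z`. A fourth element `w` would let the set that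
-- remains after `z`, of size zero, shrink once more.
third-element : ∀ {n} {p : Subset n} {x y} → ∣ p ∣ ≡ 3 → x ∈ˢ p → y ∈ˢ p → x ≢ y →
  ∃ λ z → z ∈ˢ p × z ≢ x × z ≢ y × (∀ {w} → w ∈ˢ p → w ∈ x ∷ y ∷ z ∷ [])
third-element {n} {p} {x} {y} ∣p∣≡3 x∈p y∈p x≢y
  with nonempty? (p - x - y)
     | ∣p-x∣≡pred∣p∣ (∣p-x∣≡pred∣p∣ ∣p∣≡3 x∈p) (x∈p∧x≢y⇒x∈p-y y∈p (≢-sym x≢y))
... | no empty | ∣p-x-y∣≡1 = contradiction
        (trans (sym (∣⊥∣≡0 n)) (trans (cong ∣_∣ (sym (Empty-unique empty))) ∣p-x-y∣≡1)) λ ()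
... | yes (z , z∈) | ∣p-x-y∣≡1 =
  z , p─q⊆p _ _ (p─q⊆p _ _ z∈) , x∈p-y⇒x≢y (p─q⊆p _ _ z∈) , x∈p-y⇒x≢y z∈ , exhaustive
  where
  exhaustive : ∀ {w} → w ∈ˢ p → w ∈ x ∷ y ∷ z ∷ []
  exhaustive {w} w∈p with w ≟ x | w ≟ y | w ≟ z
  ... | yes w≡x | _ | _ = here w≡x
  ... | no _ | yes w≡y | _ = there (here w≡y)
  ... | no _ | no _ | yes w≡z = there (there (here w≡z))
  ... | no w≢x | no w≢y | no w≢z = contradiction
    (subst (∣ p - x - y - z - w ∣ <_) (∣p-x∣≡pred∣p∣ ∣p-x-y∣≡1 z∈) (x∈p⇒∣p-x∣<∣p∣
      (x∈p∧x≢y⇒x∈p-y (x∈p∧x≢y⇒x∈p-y (x∈p∧x≢y⇒x∈p-y w∈p w≢x) w≢y) w≢z))) n≮0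

-- Pigeonhole: if nothing were missing from `xs`, taking indices would inject `Fin n` into the
-- positions of `xs`.
fresh : ∀ {n} (xs : List (Fin n)) → length xs < n → ∃ (_∉ xs)
fresh xs ∣xs∣<n with any? (λ x → ¬? (_∈?_ _≟_ x xs))
... | yes x∉xs = x∉xs
... | no none = contradiction ∣xs∣<n (≤⇒≯ (injective⇒≤
        {f = λ x → index (all∈ x)}
        (λ {x} {y} → index-injective (setoid _) (all∈ x) (all∈ y))))
  where
  all∈ : ∀ x → x ∈ xs
  all∈ x = decidable-stable (_∈?_ _≟_ x xs) (λ x∉ → none (x , x∉))

-- Cutting linked lists at prescribed entries.

module _ {a r} {A : Set a} {R : A → A → Set r} where

  linked-∷ʳ⁻ : ∀ xs {y} → Linked R (xs ++ y ∷ []) → Linked R xs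
  linked-∷ʳ⁻ [] _ = []
  linked-∷ʳ⁻ (_ ∷ []) _ = [-]
  linked-∷ʳ⁻ (_ ∷ xs@(_ ∷ _)) (Rxy ∷ Rxs) = Rxy ∷ linked-∷ʳ⁻ xs Rxs

  -- `zs` is the part of `ys` after `x`. Keeping `zs ⊆ ys` lets facts about all of `ys`, such as
  -- avoidance of an earlier vertex, pass to it.
  suffix-from : ∀ {x xs ys} → Unique ys → Linked R ys → x ∷ xs ⊆ ys →
    ∃ λ zs → xs ⊆ zs × zs ⊆ ys × Unique (x ∷ zs) × Linked R (x ∷ zs)
  suffix-from u l (refl ∷ xs⊆) = _ , xs⊆ , _ ∷ʳ ⊆-refl , u , l
  suffix-from (_ ∷ u) [-] (_ ∷ʳ ())
  suffix-from (_ ∷ u) (_ ∷ l) (y ∷ʳ xs⊆) with suffix-from u l xs⊆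
  ... | zs , xs⊆zs , zs⊆ , u′ , l′ = zs , xs⊆zs , y ∷ʳ zs⊆ , u′ , l′

  -- The extra head `u` guarantees that `x` has an entry `w` before it, possibly `u` itself;
  -- uniqueness separates `w` from everything after `x`.
  predecessor : ∀ {u x xs ys} → Unique (u ∷ ys) → Linked R (u ∷ ys) → x ∷ xs ⊆ ys →
    ∃₂ λ w zs → R w x × All (w ≢_) zs × xs ⊆ zs × zs ⊆ ys × Unique (x ∷ zs) × Linked R (x ∷ zs)
  predecessor ((_ ∷ u≢) ∷ un) (Rux ∷ l) (refl ∷ xs⊆) =
    _ , _ , Rux , u≢ , xs⊆ , _ ∷ʳ ⊆-refl , un , l
  predecessor (_ ∷ un) (_ ∷ l) (y ∷ʳ xs⊆) with predecessor un l xs⊆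
  ... | w , zs , Rwx , w≢ , xs⊆zs , zs⊆ , u′ , l′ = w , zs , Rwx , w≢ , xs⊆zs , y ∷ʳ zs⊆ , u′ , l′

-- Cubic and 4-ordered graphs.

module _ {n} (G : SimpleGraph n) where
  open SimpleGraph G

  ~⇒≢ : ∀ {u v} → u ~ v → u ≢ v
  ~⇒≢ u~v u≡v = ~-irrefl u≡v u~v

  ∈-neighbours⁺ : ∀ {u v} → u ~ v → v ∈ˢ neighbours u
  ∈-neighbours⁺ {u} {v} u~v =
    lookup⇒[]= v _ (trans (lookup∘tabulate _ v) (dec-true (u ~? v) u~v))

  ∈-neighbours⁻ : ∀ {u v} → v ∈ˢ neighbours u → u ~ v
  ∈-neighbours⁻ {u} {v} v∈ with u ~? v | trans (sym (lookup∘tabulate _ v)) ([]=⇒lookup v∈)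
  ... | yes u~v | _ = u~v
  ... | no _ | ()

  third-neighbour : Regular 3 → ∀ {v x y} → v ~ x → v ~ y → x ≢ y →
    ∃ λ z → v ~ z × z ≢ x × z ≢ y × (∀ {w} → v ~ w → w ∈ x ∷ y ∷ z ∷ [])
  third-neighbour reg {v} v~x v~y x≢y
    with third-element (reg v) (∈-neighbours⁺ v~x) (∈-neighbours⁺ v~y) x≢y
  ... | z , z∈ , z≢x , z≢y , ex = z , ∈-neighbours⁻ z∈ , z≢x , z≢y , ex ∘ ∈-neighbours⁺

  -- Dropping the closing edge and whatever is listed before `p` turns the cycle into a path from
  -- `p`.
  ordered⇒path : Ordered 4 → ∀ {p q r s} → Unique (p ∷ q ∷ r ∷ s ∷ []) →
    ∃ λ zs → q ∷ r ∷ s ∷ [] ⊆ zs × Unique (p ∷ zs) × Linked _~_ (p ∷ zs)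
  ordered⇒path ord uniq with ord _ refl uniq
  ... | _ , cycle _ u l , sub with suffix-from u (linked-∷ʳ⁻ _ l) sub
  ...   | zs , sub′ , _ , u′ , l′ = zs , sub′ , u′ , l′

  -- A step out of `ts` can land only on `p` or `q`, which the walk avoids.
  walk-trapped : ∀ {p q ts s zs} → (∀ {u v} → u ∈ ts → u ~ v → v ∈ p ∷ q ∷ ts) →
    s ∈ ts → Linked _~_ (s ∷ zs) → All (p ≢_) zs → All (q ≢_) zs → All (_∈ ts) zs
  walk-trapped closed s∈ [-] _ _ = []
  walk-trapped closed s∈ (s~v ∷ l) (p≢v ∷ p≢) (q≢v ∷ q≢) with closed s∈ s~v
  ... | here v≡p = contradiction (sym v≡p) p≢v
  ... | there (here v≡q) = contradiction (sym v≡q) q≢v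
  ... | there (there v∈) = v∈ ∷ walk-trapped closed v∈ l p≢ q≢

  -- Let `x` be off the list. The path for `(p, q, s, x)` has passed `p` and `q` by the time it
  -- reaches `s`, so its remainder is trapped in `s ∷ ts`, although it still has to meet `x`.
  no-separating-pair : Ordered 4 → ∀ {p q s ts} → Unique (p ∷ q ∷ s ∷ ts) →
    length (p ∷ q ∷ s ∷ ts) < n →
    ¬ (∀ {u v} → u ∈ s ∷ ts → u ~ v → v ∈ p ∷ q ∷ s ∷ ts)
  no-separating-pair ord {p} {q} {s} {ts} ((p≢q ∷ p≢s ∷ _) ∷ (q≢s ∷ _) ∷ _) small closed
    with fresh _ small
  ... | x , x∉ with ordered⇒path ord
          ((p≢q ∷ p≢s ∷ (λ p≡x → x∉ (here (sym p≡x))) ∷ [])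
          ∷ (q≢s ∷ (λ q≡x → x∉ (there (here (sym q≡x)))) ∷ [])
          ∷ ((λ s≡x → x∉ (there (there (here (sym s≡x))))) ∷ []) ∷ [] ∷ [])
  ...   | zs₁ , sub₁ , p≢zs₁ ∷ u₁ , _ ∷ l₁ with suffix-from u₁ l₁ sub₁
  ...     | zs₂ , sub₂ , zs₂⊆ , q≢zs₂ ∷ u₂ , _ ∷ l₂ with suffix-from u₂ l₂ sub₂
  ...       | zs₃ , sub₃ , zs₃⊆ , _ , l₃ =
    x∉ (there (there (All.lookup
      (walk-trapped closed (here refl) l₃
        (All-resp-⊆ zs₃⊆ (All-resp-⊆ zs₂⊆ p≢zs₁)) (All-resp-⊆ zs₃⊆ q≢zs₂))
      (lookup sub₃ (here refl)))))

  -- On the path, `w` and `v` are the vertices before and after `a`, and `t` is the one after `c`.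
  -- As `a′` comes later than `c` and `c′` is the start, `w` and `v` are not `a′` and `t` is not
  -- `c′`. So three distinct vertices lie in `b ∷ d ∷ []`.
  no-crossing : Ordered 4 → ∀ {a b c d a′ c′} → Unique (c′ ∷ a ∷ c ∷ a′ ∷ []) →
    (∀ {w} → a ~ w → w ∈ b ∷ d ∷ a′ ∷ []) → (∀ {w} → c ~ w → w ∈ b ∷ d ∷ c′ ∷ []) →
    c ≢ b → c ≢ d → ⊥
  no-crossing ord uniq Na Nc c≢b c≢d with ordered⇒path ord uniq
  no-crossing ord {a} {b} {c} {d} {a′} {c′} (_ ∷ _ ∷ (c≢a′ ∷ []) ∷ _) Na Nc c≢b c≢d
    | zs₁ , sub₁ , u₁ , l₁ with predecessor u₁ l₁ sub₁
  -- If `c` came directly after `a`, it would be one of `b`, `d`, `a′`.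
  ... | _ , .(c ∷ _) , _ , _ , refl ∷ _ , _ , _ , a~c ∷ _ with Na a~c
  ...   | here c≡b = c≢b c≡b
  ...   | there (here c≡d) = c≢d c≡d
  ...   | there (there (here c≡a′)) = c≢a′ c≡a′
  no-crossing ord {a} {b} {c} {d} {a′} {c′} uniq Na Nc c≢b c≢d
    | zs₁ , sub₁ , u₁@(c′≢zs₁ ∷ _) , l₁
    | w , .(v ∷ _) , w~a , w≢v ∷ w≢ , v ∷ʳ sub₂ , zs₂⊆ , _ ∷ v≢ ∷ u₂ , a~v ∷ l₂
    with suffix-from u₂ (Linked.tail l₂) sub₂
  -- `t` exists because `a′` still lies ahead of `c`.
  ... | t ∷ zs₃ , sub₃ , zs₃⊆ , u₃ , c~t ∷ l₃ = clash (Na (~-sym w~a)) (Na a~v) (Nc c~t)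
    where
    a′∈ = lookup zs₃⊆ (lookup sub₃ (here refl))
    t∈ = lookup zs₃⊆ (here refl)
    w≢a′ = All.lookup w≢ a′∈
    v≢a′ = All.lookup v≢ a′∈
    w≢t = All.lookup w≢ t∈
    v≢t = All.lookup v≢ t∈
    c′≢t = All.lookup c′≢zs₁ (lookup zs₂⊆ (there t∈))
    clash : w ∈ b ∷ d ∷ a′ ∷ [] → v ∈ b ∷ d ∷ a′ ∷ [] → t ∈ b ∷ d ∷ c′ ∷ [] → ⊥
    clash (there (there (here e))) _ _ = w≢a′ e
    clash _ (there (there (here e))) _ = v≢a′ e
    clash _ _ (there (there (here e))) = c′≢t (sym e)
    clash (here refl) (here e) _ = w≢v (sym e)
    clash (here refl) _ (here e) = w≢t (sym e)
    clash _ (here refl) (here e) = v≢t (sym e)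
    clash (there (here refl)) (there (here e)) _ = w≢v (sym e)
    clash (there (here refl)) _ (there (here e)) = w≢t (sym e)
    clash _ (there (here refl)) (there (here e)) = v≢t (sym e)

  -- The complete neighbour lists of both corners are kept so that the square can later be shown to
  -- have only two exits.
  opposite-corners : Ordered 4 → Regular 3 → n > 6 → ∀ {a b c d} →
    a ~ b → a ~ d → c ~ b → c ~ d → a ≢ c → b ≢ d →
    ∃ λ e → a ~ e × c ~ e × e ≢ b × e ≢ d ×
      (∀ {w} → a ~ w → w ∈ b ∷ d ∷ e ∷ []) × (∀ {w} → c ~ w → w ∈ b ∷ d ∷ e ∷ [])
  opposite-corners ord reg n>6 {a} {b} {c} {d} a~b a~d c~b c~d a≢c b≢d
    with third-neighbour reg a~b a~d b≢d | third-neighbour reg c~b c~d b≢d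
  ... | a′ , a~a′ , a′≢b , a′≢d , Na | c′ , c~c′ , c′≢b , c′≢d , Nc with a′ ≟ c′
  ...   | yes refl = a′ , a~a′ , c~c′ , a′≢b , a′≢d , Na , Nc
  ...   | no a′≢c′ with a ~? c
  -- Without the chord, `c′`, `a`, `c` and `a′` are four distinct vertices.
  ...     | no a≁c = ⊥-elim (no-crossing ord
            ((c′≢a ∷ ≢-sym (~⇒≢ c~c′) ∷ ≢-sym a′≢c′ ∷ [])
            ∷ (a≢c ∷ ~⇒≢ a~a′ ∷ []) ∷ (c≢a′ ∷ []) ∷ [] ∷ []) Na Nc (~⇒≢ c~b) (~⇒≢ c~d))
    where
    c′≢a : c′ ≢ a
    c′≢a refl = a≁c (~-sym c~c′)
    c≢a′ : c ≢ a′
    c≢a′ refl = a≁c a~a′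
  -- The chord makes `a′` equal to `c` and `c′` equal to `a`, so `b` and `d` are the only exits from
  -- the pair.
  ...     | yes a~c = ⊥-elim (no-separating-pair ord
            ((b≢d ∷ ≢-sym (~⇒≢ a~b) ∷ ≢-sym (~⇒≢ c~b) ∷ [])
            ∷ (≢-sym (~⇒≢ a~d) ∷ ≢-sym (~⇒≢ c~d) ∷ []) ∷ (a≢c ∷ []) ∷ [] ∷ [])
            -- Four listed vertices must leave a fifth; `n > 6` unfolds to `7 ≤ n`, and 7 is 5 + 2.
            (≤-trans (m≤m+n 5 2) n>6) closed)
    where
    c≡a′ : c ≡ a′
    c≡a′ with Na a~c
    ... | here c≡b = contradiction c≡b (~⇒≢ c~b)
    ... | there (here c≡d) = contradiction c≡d (~⇒≢ c~d)
    ... | there (there (here e)) = e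
    a≡c′ : a ≡ c′
    a≡c′ with Nc (~-sym a~c)
    ... | here a≡b = contradiction a≡b (~⇒≢ a~b)
    ... | there (here a≡d) = contradiction a≡d (~⇒≢ a~d)
    ... | there (there (here e)) = e
    closed : ∀ {u v} → u ∈ a ∷ c ∷ [] → u ~ v → v ∈ b ∷ d ∷ a ∷ c ∷ []
    closed (here refl) = All.lookup (here refl ∷ there (here refl)
      ∷ there (there (there (here (sym c≡a′)))) ∷ []) ∘ Na
    closed (there (here refl)) = All.lookup (here refl ∷ there (here refl)
      ∷ there (there (here (sym a≡c′))) ∷ []) ∘ Nc

theorem2p1 : (n : ℕ) (G : SimpleGraph n) → n > 6 →
    SimpleGraph.Connected G → SimpleGraph.Regular G 3 →
    SimpleGraph.Ordered G 4 → ¬ SimpleGraph.HasCycleOfLength G 4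
theorem2p1 n G n>6 _ reg ord
  (a ∷ b ∷ c ∷ d ∷ [] ,
   SimpleGraph.cycle _ ((a≢b ∷ a≢c ∷ a≢d ∷ []) ∷ (b≢c ∷ b≢d ∷ []) ∷ (c≢d ∷ []) ∷ [] ∷ [])
     (a~b ∷ b~c ∷ c~d ∷ d~a ∷ [-]) , refl)
  with opposite-corners G ord reg n>6 a~b (~-sym d~a) (~-sym b~c) c~d a≢c b≢d
     | opposite-corners G ord reg n>6 (~-sym a~b) b~c d~a (~-sym c~d) b≢d a≢c
  where open SimpleGraph G
... | e , a~e , c~e , e≢b , e≢d , Na , Nc | f , b~f , d~f , f≢a , f≢c , Nb , Nd =
  -- The square with `e` and `f` makes six vertices, and `n > 6` supplies one outside. With six
  -- vertices in all, as in the complete bipartite graph on 3 + 3 vertices, nothing would be cut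
  -- off.
  no-separating-pair G ord
    ((e≢f ∷ ≢-sym (~⇒≢ G a~e) ∷ e≢b ∷ ≢-sym (~⇒≢ G c~e) ∷ e≢d ∷ [])
    ∷ (f≢a ∷ ≢-sym (~⇒≢ G b~f) ∷ f≢c ∷ ≢-sym (~⇒≢ G d~f) ∷ [])
    ∷ (a≢b ∷ a≢c ∷ a≢d ∷ []) ∷ (b≢c ∷ b≢d ∷ []) ∷ (c≢d ∷ []) ∷ [] ∷ []) n>6 closed
  where
  open SimpleGraph G
  -- Otherwise a, b, c, d would be four neighbours of e.
  e≢f : e ≢ f
  e≢f refl with third-neighbour G reg (~-sym a~e) (~-sym c~e) a≢c
  ... | _ , _ , _ , _ , Ne with Ne (~-sym b~f) | Ne (~-sym d~f)
  ...   | here b≡a | _ = a≢b (sym b≡a)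
  ...   | there (here b≡c) | _ = b≢c b≡c
  ...   | there (there (here _)) | here d≡a = a≢d (sym d≡a)
  ...   | there (there (here _)) | there (here d≡c) = c≢d (sym d≡c)
  ...   | there (there (here b≡t)) | there (there (here d≡t)) = b≢d (trans b≡t (sym d≡t))
  square+ : List (Fin n)
  square+ = e ∷ f ∷ a ∷ b ∷ c ∷ d ∷ []
  bde⊆ : All (_∈ square+) (b ∷ d ∷ e ∷ [])
  bde⊆ = there (there (there (here refl)))
    ∷ there (there (there (there (there (here refl))))) ∷ here refl ∷ []
  acf⊆ : All (_∈ square+) (a ∷ c ∷ f ∷ [])
  acf⊆ = there (there (here refl))
    ∷ there (there (there (there (here refl)))) ∷ there (here refl) ∷ []
  closed : ∀ {u v} → u ∈ a ∷ b ∷ c ∷ d ∷ [] → u ~ v → v ∈ square+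
  closed (here refl) = All.lookup bde⊆ ∘ Na
  closed (there (here refl)) = All.lookup acf⊆ ∘ Nb
  closed (there (there (here refl))) = All.lookup bde⊆ ∘ Nc
  closed (there (there (there (here refl)))) = All.lookup acf⊆ ∘ Nd
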